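{- For all $m,j\in\mathbb{N}$, as an identity of rational functions in independent indeterminates $q$ and $t$, \[ \frac{1}{(q)_j}\sum_{n=0}^{m}q^{mn}\frac{(q^{ -m})_n\,(tq^{ -n})_j}{(q)_n}= \begin{cases}0 & (0\le j<m),\\[2pt] (q^{ -1}t)^m\dfrac{(t)_{j-m}}{(q)_{j-m}} & (m\le j).\end{cases} \]
   Context: For $x$ and $n\in\mathbb{N}$, $(x)_n=\prod_{k=0}^{n-1}(1-xq^k)$, with $(x)_0=1$. -}

module Defs where

open import Data.Nat using (ℕ; zero; suc; _∸_)
open import Data.Rational using (ℚ; 0ℚ; 1ℚ; _+_; _*_; _-_; _÷_; ≢-nonZero)
open import Relation.Binary.PropositionalEquality using (_≢_)

_^ℚ_ : ℚ → ℕ → ℚ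
x ^ℚ zero  = 1ℚ
x ^ℚ suc n = x * (x ^ℚ n)

div : ℚ → (y : ℚ) → y ≢ 0ℚ → ℚ
div x y y≢0 = _÷_ x y {{≢-nonZero y≢0}}

-- q-Pochhammer symbol with base q:  poch q x n = (x)_n = ∏_{k=0}^{n-1} (1 - x q^k)
poch : ℚ → ℚ → ℕ → ℚ
poch q x zero    = 1ℚ
poch q x (suc n) = poch q x n * (1ℚ - x * (q ^ℚ n))

sumTo : ℕ → (ℕ → ℚ) → ℚ
sumTo zero    f = f 0
sumTo (suc m) f = sumTo m f + f (suc m)

{-# OPTIONS --safe #-}
module Submission where

-- Write c m n = q^(mn) (q^-m)_n / (q)_n.  The coefficients satisfy
-- c (m+1) (n+1) = q^(n+1) c m (n+1) - q^n c m n and c m (m+1) = 0, so summation by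
-- parts turns the sum for m+1 into the sum for m applied to the q-difference
-- q^n (P n - P (n+1)) of P n = (t q^-n)_(j+1), which is q^-1 t (1 - q^(j+1)) (t q^-n)_j.
-- Hence the left-hand side L m j satisfies L (m+1) (j+1) = q^-1 t L m j,
-- L (m+1) 0 = 0 and L 0 j = (t)_j / (q)_j, and both cases follow by induction on m.

open import Defs
open import Data.Nat using (ℕ; zero; suc; _∸_; _<_; _≤_; s≤s)
import Data.Nat.Properties as ℕ
open import Data.Product using (_×_; _,_)
open import Data.Rational using (ℚ; 0ℚ; 1ℚ; _+_; _*_; _-_; 1/_; NonZero; ≢-nonZero)
open import Data.Rational.Properties
  using ( +-*-commutativeRing; _≟_; *-assoc; *-distribʳ-+; +-identityʳ
        ; *-identityˡ; *-identityʳ; *-zeroˡ; *-zeroʳ; *-inverseˡ; *-inverseʳ; *-comm)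
open import Relation.Binary.PropositionalEquality
  using (_≡_; _≢_; refl; sym; trans; cong; cong₂; module ≡-Reasoning)
open import Relation.Nullary.Decidable using (dec⇒maybe)
open import Tactic.RingSolver using (solve-∀)
open import Tactic.RingSolver.Core.AlmostCommutativeRing
  using (AlmostCommutativeRing; fromCommutativeRing)
open ≡-Reasoning

ℚ-ring : AlmostCommutativeRing _ _
ℚ-ring = fromCommutativeRing +-*-commutativeRing (λ y → dec⇒maybe (0ℚ ≟ y))

sumTo-cong : ∀ m {f g : ℕ → ℚ} → (∀ n → f n ≡ g n) → sumTo m f ≡ sumTo m g
sumTo-cong zero    f≡g = f≡g 0
sumTo-cong (suc m) f≡g = cong₂ _+_ (sumTo-cong m f≡g) (f≡g (suc m))

sumTo-*ʳ : ∀ m a (f : ℕ → ℚ) → sumTo m (λ n → f n * a) ≡ sumTo m f * a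
sumTo-*ʳ zero    a f = refl
sumTo-*ʳ (suc m) a f = begin
  sumTo m (λ n → f n * a) + f (suc m) * a ≡⟨ cong (_+ f (suc m) * a) (sumTo-*ʳ m a f) ⟩
  sumTo m f * a + f (suc m) * a           ≡⟨ sym (*-distribʳ-+ a (sumTo m f) (f (suc m))) ⟩
  (sumTo m f + f (suc m)) * a             ∎

sumTo-by-parts : ∀ m (u d P : ℕ → ℚ) → d 0 ≡ u 0 → (∀ n → d (suc n) ≡ u (suc n) - u n) →
  sumTo (suc m) (λ n → d n * P n)
    ≡ sumTo m (λ n → u n * (P n - P (suc n))) + u (suc m) * P (suc m)
sumTo-by-parts zero u d P d₀ dₛ = begin
  d 0 * P 0 + d 1 * P 1         ≡⟨ cong₂ (λ a b → a * P 0 + b * P 1) d₀ (dₛ 0) ⟩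
  u 0 * P 0 + (u 1 - u 0) * P 1 ≡⟨ regroup (u 0) (u 1) (P 0) (P 1) ⟩
  u 0 * (P 0 - P 1) + u 1 * P 1 ∎
  where
  regroup : ∀ u₀ u₁ p₀ p₁ → u₀ * p₀ + (u₁ - u₀) * p₁ ≡ u₀ * (p₀ - p₁) + u₁ * p₁
  regroup = solve-∀ ℚ-ring
sumTo-by-parts (suc m) u d P d₀ dₛ = begin
  sumTo (suc m) (λ n → d n * P n) + d (2+ m) * P (2+ m)
    ≡⟨ cong₂ _+_ (sumTo-by-parts m u d P d₀ dₛ) (cong (_* P (2+ m)) (dₛ (suc m))) ⟩
  s + u (suc m) * P (suc m) + (u (2+ m) - u (suc m)) * P (2+ m)
    ≡⟨ regroup s (u (suc m)) (u (2+ m)) (P (suc m)) (P (2+ m)) ⟩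
  s + u (suc m) * (P (suc m) - P (2+ m)) + u (2+ m) * P (2+ m) ∎
  where
  2+ : ℕ → ℕ
  2+ k = suc (suc k)
  s : ℚ
  s = sumTo m (λ n → u n * (P n - P (suc n)))
  regroup : ∀ s u₁ u₂ p₁ p₂ →
    s + u₁ * p₁ + (u₂ - u₁) * p₂ ≡ s + u₁ * (p₁ - p₂) + u₂ * p₂
  regroup = solve-∀ ℚ-ring

^ℚ-distribˡ-+-* : ∀ y a b → y ^ℚ (a Data.Nat.+ b) ≡ y ^ℚ a * y ^ℚ b
^ℚ-distribˡ-+-* y zero    b = sym (*-identityˡ _)
^ℚ-distribˡ-+-* y (suc a) b = trans (cong (y *_) (^ℚ-distribˡ-+-* y a b)) (sym (*-assoc y _ _))

^ℚ-distribʳ-* : ∀ y z n → (y * z) ^ℚ n ≡ y ^ℚ n * z ^ℚ n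
^ℚ-distribʳ-* y z zero    = refl
^ℚ-distribʳ-* y z (suc n) = trans (cong ((y * z) *_) (^ℚ-distribʳ-* y z n)) (interchange y z _ _)
  where
  interchange : ∀ a b c d → a * b * (c * d) ≡ a * c * (b * d)
  interchange = solve-∀ ℚ-ring

^ℚ-zeroˡ : ∀ n → 1ℚ ^ℚ n ≡ 1ℚ
^ℚ-zeroˡ zero    = refl
^ℚ-zeroˡ (suc n) = trans (*-identityˡ _) (^ℚ-zeroˡ n)

^ℚ-inverse : ∀ {x y} → x * y ≡ 1ℚ → ∀ n → x ^ℚ n * y ^ℚ n ≡ 1ℚ
^ℚ-inverse {x} {y} x*y≡1 n = begin
  x ^ℚ n * y ^ℚ n ≡⟨ sym (^ℚ-distribʳ-* x y n) ⟩
  (x * y) ^ℚ n    ≡⟨ cong (_^ℚ n) x*y≡1 ⟩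
  1ℚ ^ℚ n         ≡⟨ ^ℚ-zeroˡ n ⟩
  1ℚ              ∎

a*[1-b*c]≡a-c : ∀ a b → b * a ≡ 1ℚ → ∀ c → a * (1ℚ - b * c) ≡ a - c
a*[1-b*c]≡a-c a b b*a≡1 c = begin
  a * (1ℚ - b * c)  ≡⟨ expand a b c ⟩
  a - (b * a) * c   ≡⟨ cong (λ e → a - e * c) b*a≡1 ⟩
  a - 1ℚ * c        ≡⟨ cong (a -_) (*-identityˡ c) ⟩
  a - c             ∎
  where
  expand : ∀ a b c → a * (1ℚ - b * c) ≡ a - (b * a) * c
  expand = solve-∀ ℚ-ring

inverse-of-*ʳ : ∀ a b c d → a * b * c ≡ 1ℚ → a * d ≡ 1ℚ → c * b ≡ d
inverse-of-*ʳ a b c d abc≡1 ad≡1 = begin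
  c * b              ≡⟨ sym (*-identityʳ _) ⟩
  c * b * 1ℚ         ≡⟨ cong (c * b *_) (sym ad≡1) ⟩
  c * b * (a * d)    ≡⟨ regroup a b c d ⟩
  a * b * c * d      ≡⟨ cong (_* d) abc≡1 ⟩
  1ℚ * d             ≡⟨ *-identityˡ d ⟩
  d                  ∎
  where
  regroup : ∀ a b c d → c * b * (a * d) ≡ a * b * c * d
  regroup = solve-∀ ℚ-ring

poch-suc-shift : ∀ q {w z} n → w * q ≡ z → poch q w (suc n) ≡ (1ℚ - w) * poch q z n
poch-suc-shift q {w} zero _ = first-factor w
  where
  first-factor : ∀ w → 1ℚ * (1ℚ - w * 1ℚ) ≡ (1ℚ - w) * 1ℚ
  first-factor = solve-∀ ℚ-ring
poch-suc-shift q {w} {z} (suc n) w*q≡z = begin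
  poch q w (suc n) * (1ℚ - w * (q * q ^ℚ n))
    ≡⟨ cong (_* (1ℚ - w * (q * q ^ℚ n))) (poch-suc-shift q n w*q≡z) ⟩
  (1ℚ - w) * poch q z n * (1ℚ - w * (q * q ^ℚ n))
    ≡⟨ regroup w q (poch q z n) (q ^ℚ n) ⟩
  (1ℚ - w) * (poch q z n * (1ℚ - w * q * q ^ℚ n))
    ≡⟨ cong (λ e → (1ℚ - w) * (poch q z n * (1ℚ - e * q ^ℚ n))) w*q≡z ⟩
  (1ℚ - w) * poch q z (suc n) ∎
  where
  regroup : ∀ w q y e → (1ℚ - w) * y * (1ℚ - w * (q * e)) ≡ (1ℚ - w) * (y * (1ℚ - w * q * e))
  regroup = solve-∀ ℚ-ring

-- x stands for q⁻¹ and inv n for 1 / (q)_n; only these defining relations are used.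
module PochhammerSum (q x : ℚ) (x*q≡1 : x * q ≡ 1ℚ) (t : ℚ) (inv : ℕ → ℚ)
    (inv-zero : inv 0 ≡ 1ℚ) (inv-suc : ∀ n → inv (suc n) * (1ℚ - q ^ℚ suc n) ≡ inv n) where

  x^n*q^n≡1 : ∀ n → x ^ℚ n * q ^ℚ n ≡ 1ℚ
  x^n*q^n≡1 = ^ℚ-inverse x*q≡1

  x*y*q≡y : ∀ y → x * y * q ≡ y
  x*y*q≡y y = begin
    x * y * q   ≡⟨ rearrange x y q ⟩
    y * (x * q) ≡⟨ cong (y *_) x*q≡1 ⟩
    y * 1ℚ      ≡⟨ *-identityʳ y ⟩
    y           ∎
    where
    rearrange : ∀ x y q → x * y * q ≡ y * (x * q)
    rearrange = solve-∀ ℚ-ring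

  coeff : ℕ → ℕ → ℚ
  coeff m n = q ^ℚ (m Data.Nat.* n) * poch q (x ^ℚ m) n * inv n

  coeff-zero : ∀ m → coeff m 0 ≡ 1ℚ
  coeff-zero m = cong₂ (λ k i → q ^ℚ k * 1ℚ * i) (ℕ.*-zeroʳ m) inv-zero

  coeff-top : ∀ m → coeff m (suc m) ≡ 0ℚ
  coeff-top m = begin
    g * (poch q (x ^ℚ m) m * (1ℚ - x ^ℚ m * q ^ℚ m)) * i
      ≡⟨ cong (λ e → g * (poch q (x ^ℚ m) m * (1ℚ - e)) * i) (x^n*q^n≡1 m) ⟩
    g * (poch q (x ^ℚ m) m * (1ℚ - 1ℚ)) * i
      ≡⟨ vanish g (poch q (x ^ℚ m) m) i ⟩
    0ℚ ∎
    where
    g i : ℚ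
    g = q ^ℚ (m Data.Nat.* suc m)
    i = inv (suc m)
    vanish : ∀ a b c → a * (b * (1ℚ - 1ℚ)) * c ≡ 0ℚ
    vanish = solve-∀ ℚ-ring

  coeff-suc : ∀ m n → coeff (suc m) (suc n) ≡ q ^ℚ suc n * coeff m (suc n) - q ^ℚ n * coeff m n
  coeff-suc m n = begin
    q ^ℚ (suc m Data.Nat.* suc n) * poch q (x * X) (suc n) * J
      ≡⟨ cong₂ (λ e p → e * p * J) power-left (poch-suc-shift q n (x*y*q≡y X)) ⟩
    q * N * (P * G) * ((1ℚ - x * X) * A) * J
      ≡⟨ collect-left q N P G x X A J ⟩
    N * G * A * J * ((q * P) * (1ℚ - (x * X) * 1ℚ))
      ≡⟨ cong (N * G * A * J *_) (a*[1-b*c]≡a-c (q * P) (x * X) (x^n*q^n≡1 (suc m)) 1ℚ) ⟩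
    N * G * A * J * (q * P - 1ℚ)
      ≡⟨ expand q N P G A J ⟩
    N * G * A * J * (q * (P - N) - (1ℚ - q * N))
      ≡⟨ cong (λ e → N * G * A * J * (q * e - (1ℚ - q * N)))
              (sym (a*[1-b*c]≡a-c P X (x^n*q^n≡1 m) N)) ⟩
    N * G * A * J * (q * (P * (1ℚ - X * N)) - (1ℚ - q * N))
      ≡⟨ collect-right q N P G X A J ⟩
    q * N * (P * G * (A * (1ℚ - X * N)) * J) - N * (G * A * (J * (1ℚ - q * N)))
      ≡⟨ cong₂ (λ e i → q * N * (e * (A * (1ℚ - X * N)) * J) - N * (G * A * i))
               (sym power-right) (inv-suc n) ⟩
    q ^ℚ suc n * coeff m (suc n) - q ^ℚ n * coeff m n ∎
    where
    N P G X A J : ℚ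
    N = q ^ℚ n
    P = q ^ℚ m
    G = q ^ℚ (m Data.Nat.* n)
    X = x ^ℚ m
    A = poch q X n
    J = inv (suc n)
    power-right : q ^ℚ (m Data.Nat.* suc n) ≡ P * G
    power-right = trans (cong (q ^ℚ_) (ℕ.*-suc m n)) (^ℚ-distribˡ-+-* q m (m Data.Nat.* n))
    power-left : q ^ℚ (suc m Data.Nat.* suc n) ≡ q * N * (P * G)
    power-left = trans (^ℚ-distribˡ-+-* q (suc n) (m Data.Nat.* suc n)) (cong (q * N *_) power-right)
    collect-left : ∀ q N P G x X A J →
      q * N * (P * G) * ((1ℚ - x * X) * A) * J ≡ N * G * A * J * ((q * P) * (1ℚ - (x * X) * 1ℚ))
    collect-left = solve-∀ ℚ-ring
    expand : ∀ q N P G A J →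
      N * G * A * J * (q * P - 1ℚ) ≡ N * G * A * J * (q * (P - N) - (1ℚ - q * N))
    expand = solve-∀ ℚ-ring
    collect-right : ∀ q N P G X A J →
      N * G * A * J * (q * (P * (1ℚ - X * N)) - (1ℚ - q * N))
        ≡ q * N * (P * G * (A * (1ℚ - X * N)) * J) - N * (G * A * (J * (1ℚ - q * N)))
    collect-right = solve-∀ ℚ-ring

  coeff-by-parts : ∀ m (P : ℕ → ℚ) →
    sumTo (suc m) (λ n → coeff (suc m) n * P n)
      ≡ sumTo m (λ n → coeff m n * (q ^ℚ n * (P n - P (suc n))))
  coeff-by-parts m P = begin
    sumTo (suc m) (λ n → coeff (suc m) n * P n)
      ≡⟨ sumTo-by-parts m u (coeff (suc m)) P coeff₀ (coeff-suc m) ⟩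
    sumTo m (λ n → u n * (P n - P (suc n))) + u (suc m) * P (suc m)
      ≡⟨ cong₂ _+_ (sumTo-cong m (λ n → regroup (q ^ℚ n) (coeff m n) (P n - P (suc n))))
                   boundary ⟩
    sumTo m (λ n → coeff m n * (q ^ℚ n * (P n - P (suc n)))) + 0ℚ
      ≡⟨ +-identityʳ _ ⟩
    sumTo m (λ n → coeff m n * (q ^ℚ n * (P n - P (suc n)))) ∎
    where
    u : ℕ → ℚ
    u n = q ^ℚ n * coeff m n
    coeff₀ : coeff (suc m) 0 ≡ 1ℚ * coeff m 0
    coeff₀ = trans (coeff-zero (suc m)) (sym (trans (*-identityˡ _) (coeff-zero m)))
    boundary : u (suc m) * P (suc m) ≡ 0ℚ
    boundary = begin
      q ^ℚ suc m * coeff m (suc m) * P (suc m)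
        ≡⟨ cong (λ c → q ^ℚ suc m * c * P (suc m)) (coeff-top m) ⟩
      q ^ℚ suc m * 0ℚ * P (suc m)
        ≡⟨ cong (_* P (suc m)) (*-zeroʳ (q ^ℚ suc m)) ⟩
      0ℚ * P (suc m)
        ≡⟨ *-zeroˡ (P (suc m)) ⟩
      0ℚ ∎
    regroup : ∀ a c d → a * c * d ≡ c * (a * d)
    regroup = solve-∀ ℚ-ring

  shifted : ℕ → ℕ → ℚ
  shifted j n = poch q (t * x ^ℚ n) j

  shifted-difference : ∀ j n →
    q ^ℚ n * (shifted (suc j) n - shifted (suc j) (suc n)) ≡ x * t * (1ℚ - q ^ℚ suc j) * shifted j n
  shifted-difference j n = begin
    N * (Y * (1ℚ - t * X * Q) - shifted (suc j) (suc n))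
      ≡⟨ cong (λ p → N * (Y * (1ℚ - t * X * Q) - p)) (poch-suc-shift q j t*x*X*q≡t*X) ⟩
    N * (Y * (1ℚ - t * X * Q) - (1ℚ - t * (x * X)) * Y)
      ≡⟨ factor N Y t X Q x ⟩
    Y * t * (X * N) * (x - Q)
      ≡⟨ cong₂ (λ e f → Y * t * e * f) (x^n*q^n≡1 n)
               (sym (a*[1-b*c]≡a-c x q (trans (*-comm q x) x*q≡1) Q)) ⟩
    Y * t * 1ℚ * (x * (1ℚ - q * Q))
      ≡⟨ reorder Y t x q Q ⟩
    x * t * (1ℚ - q * Q) * Y ∎
    where
    N X Q Y : ℚ
    N = q ^ℚ n
    X = x ^ℚ n
    Q = q ^ℚ j
    Y = shifted j n
    t*x*X*q≡t*X : t * (x * X) * q ≡ t * X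
    t*x*X*q≡t*X = trans (*-assoc t (x * X) q) (cong (t *_) (x*y*q≡y X))
    factor : ∀ N Y t X Q x →
      N * (Y * (1ℚ - t * X * Q) - (1ℚ - t * (x * X)) * Y) ≡ Y * t * (X * N) * (x - Q)
    factor = solve-∀ ℚ-ring
    reorder : ∀ Y t x q Q → Y * t * 1ℚ * (x * (1ℚ - q * Q)) ≡ x * t * (1ℚ - q * Q) * Y
    reorder = solve-∀ ℚ-ring

  sum : ℕ → ℕ → ℚ
  sum m j = sumTo m (λ n → coeff m n * shifted j n)

  sum-suc-zero : ∀ m → sum (suc m) 0 ≡ 0ℚ
  sum-suc-zero m = begin
    sum (suc m) 0                                    ≡⟨ coeff-by-parts m (shifted 0) ⟩
    sumTo m (λ n → coeff m n * (q ^ℚ n * (1ℚ - 1ℚ))) ≡⟨ sumTo-cong m (λ n → vanish (coeff m n) (q ^ℚ n)) ⟩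
    sumTo m (λ n → coeff m n * q ^ℚ n * 0ℚ)          ≡⟨ sumTo-*ʳ m 0ℚ _ ⟩
    sumTo m (λ n → coeff m n * q ^ℚ n) * 0ℚ          ≡⟨ *-zeroʳ (sumTo m (λ n → coeff m n * q ^ℚ n)) ⟩
    0ℚ                                               ∎
    where
    vanish : ∀ c a → c * (a * (1ℚ - 1ℚ)) ≡ c * a * 0ℚ
    vanish = solve-∀ ℚ-ring

  sum-suc-suc : ∀ m j → sum (suc m) (suc j) ≡ sum m j * (x * t * (1ℚ - q ^ℚ suc j))
  sum-suc-suc m j = begin
    sum (suc m) (suc j)
      ≡⟨ coeff-by-parts m (shifted (suc j)) ⟩
    sumTo m (λ n → coeff m n * (q ^ℚ n * (shifted (suc j) n - shifted (suc j) (suc n))))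
      ≡⟨ sumTo-cong m (λ n → cong (coeff m n *_) (shifted-difference j n)) ⟩
    sumTo m (λ n → coeff m n * (κ * shifted j n))
      ≡⟨ sumTo-cong m (λ n → regroup (coeff m n) κ (shifted j n)) ⟩
    sumTo m (λ n → coeff m n * shifted j n * κ)
      ≡⟨ sumTo-*ʳ m κ _ ⟩
    sum m j * κ ∎
    where
    κ : ℚ
    κ = x * t * (1ℚ - q ^ℚ suc j)
    regroup : ∀ c k y → c * (k * y) ≡ c * y * k
    regroup = solve-∀ ℚ-ring

  ratio : ℕ → ℕ → ℚ
  ratio m j = sum m j * inv j

  ratio-zero : ∀ j → ratio 0 j ≡ poch q t j * inv j
  ratio-zero j = begin
    coeff 0 0 * poch q (t * 1ℚ) j * inv j
      ≡⟨ cong₂ (λ c z → c * poch q z j * inv j) (coeff-zero 0) (*-identityʳ t) ⟩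
    1ℚ * poch q t j * inv j
      ≡⟨ cong (_* inv j) (*-identityˡ (poch q t j)) ⟩
    poch q t j * inv j ∎

  ratio-suc-zero : ∀ m → ratio (suc m) 0 ≡ 0ℚ
  ratio-suc-zero m = trans (cong (_* inv 0) (sum-suc-zero m)) (*-zeroˡ (inv 0))

  ratio-suc-suc : ∀ m j → ratio (suc m) (suc j) ≡ x * t * ratio m j
  ratio-suc-suc m j = begin
    sum (suc m) (suc j) * inv (suc j)
      ≡⟨ cong (_* inv (suc j)) (sum-suc-suc m j) ⟩
    sum m j * (x * t * (1ℚ - q ^ℚ suc j)) * inv (suc j)
      ≡⟨ regroup (sum m j) (x * t) (1ℚ - q ^ℚ suc j) (inv (suc j)) ⟩
    x * t * (sum m j * (inv (suc j) * (1ℚ - q ^ℚ suc j)))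
      ≡⟨ cong (λ i → x * t * (sum m j * i)) (inv-suc j) ⟩
    x * t * ratio m j ∎
    where
    regroup : ∀ s a e i → s * (a * e) * i ≡ a * (s * (i * e))
    regroup = solve-∀ ℚ-ring

  ratio-vanishes : ∀ m j → j < m → ratio m j ≡ 0ℚ
  ratio-vanishes (suc m) zero    _         = ratio-suc-zero m
  ratio-vanishes (suc m) (suc j) (s≤s j<m) = begin
    ratio (suc m) (suc j) ≡⟨ ratio-suc-suc m j ⟩
    x * t * ratio m j     ≡⟨ cong (x * t *_) (ratio-vanishes m j j<m) ⟩
    x * t * 0ℚ            ≡⟨ *-zeroʳ (x * t) ⟩
    0ℚ                    ∎

  ratio-closed-form : ∀ m j → m ≤ j →
    ratio m j ≡ (x * t) ^ℚ m * (poch q t (j ∸ m) * inv (j ∸ m))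
  ratio-closed-form zero    j       _         = trans (ratio-zero j) (sym (*-identityˡ _))
  ratio-closed-form (suc m) (suc j) (s≤s m≤j) = begin
    ratio (suc m) (suc j)               ≡⟨ ratio-suc-suc m j ⟩
    x * t * ratio m j                   ≡⟨ cong (x * t *_) (ratio-closed-form m j m≤j) ⟩
    x * t * ((x * t) ^ℚ m * r)          ≡⟨ sym (*-assoc (x * t) ((x * t) ^ℚ m) r) ⟩
    (x * t) ^ℚ suc m * r                ∎
    where
    r : ℚ
    r = poch q t (j ∸ m) * inv (j ∸ m)

  lhs : ℕ → ℕ → ℚ
  lhs m j = sumTo m (λ n → q ^ℚ (m Data.Nat.* n) * (poch q (x ^ℚ m) n * shifted j n * inv n)) * inv j

  lhs≡ratio : ∀ m j → lhs m j ≡ ratio m j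
  lhs≡ratio m j = cong (_* inv j) (sumTo-cong m λ n →
    regroup (q ^ℚ (m Data.Nat.* n)) (poch q (x ^ℚ m) n) (shifted j n) (inv n))
    where
    regroup : ∀ g a p i → g * (a * p * i) ≡ g * a * i * p
    regroup = solve-∀ ℚ-ring

lemma3p2 : (q t : ℚ) (q≢0 : q ≢ 0ℚ) (pq≢0 : (k : ℕ) → poch q q k ≢ 0ℚ) (m j : ℕ) →
    let q⁻¹ = div 1ℚ q q≢0
        lhs = div (sumTo m (λ n → (q ^ℚ (m Data.Nat.* n)) *
                div (poch q (q⁻¹ ^ℚ m) n * poch q (t * (q⁻¹ ^ℚ n)) j) (poch q q n) (pq≢0 n)))
                (poch q q j) (pq≢0 j)
    in (j < m → lhs ≡ 0ℚ)
     × (m ≤ j → lhs ≡ ((q⁻¹ * t) ^ℚ m) * div (poch q t (j ∸ m)) (poch q q (j ∸ m)) (pq≢0 (j ∸ m)))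
lemma3p2 q t q≢0 pq≢0 m j =
    (λ j<m → trans (lhs≡ratio m j) (ratio-vanishes m j j<m))
  , (λ m≤j → trans (lhs≡ratio m j) (ratio-closed-form m j m≤j))
  where
  -- div a y _ unfolds to a * 1/ y, so the frozen left-hand side is lhs m j definitionally.
  q⁻¹ : ℚ
  q⁻¹ = div 1ℚ q q≢0
  q⁻¹*q≡1 : q⁻¹ * q ≡ 1ℚ
  q⁻¹*q≡1 = trans (cong (_* q) (*-identityˡ ((1/ q) {{q≠0}}))) (*-inverseˡ q {{q≠0}})
    where
    q≠0 : NonZero q
    q≠0 = ≢-nonZero q≢0
  recip : ℕ → ℚ
  recip n = (1/ poch q q n) {{≢-nonZero (pq≢0 n)}}
  recip-suc : ∀ n → recip (suc n) * (1ℚ - q ^ℚ suc n) ≡ recip n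
  recip-suc n = inverse-of-*ʳ (poch q q n) (1ℚ - q ^ℚ suc n) (recip (suc n)) (recip n)
    (*-inverseʳ (poch q q (suc n)) {{≢-nonZero (pq≢0 (suc n))}})
    (*-inverseʳ (poch q q n) {{≢-nonZero (pq≢0 n)}})
  open PochhammerSum q q⁻¹ q⁻¹*q≡1 t recip refl recip-suc
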